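{- Let $G$ be a connected unit interval graph. Then the following orderings of $V(G)$ are all the same, up to reversal and permutation of true twin vertices (i.e. any two orderings, each of any one of the types below, coincide after possibly reversing one of them and permuting vertices within classes of true twins): (1) the Interval Ordering of a realizer of $G$; (2) a Consecutive Neighbourhood Ordering of $G$; (3) a Left-Right Ordering of $G$; (4) the ordering $\mathrm{minBFS}(r)$, where $r$ is an anchor of $G$; (5) an Indifference Ordering of $G$; (6) a Bisimplicial Elimination Ordering of $G$.
   Context: Graphs are finite, simple and undirected; $G=(V,E)$; $N[v]=N(v)\cup\{v\}$. Two vertices $x,y$ are true twins if $xy\in E$ and $N(x)\setminus\{y\}=N(y)\setminus\{x\}$, i.e. $N[x]=N[y]$. A graph is a unit interval graph (UIG) if it has a realizer, i.e. a family of closed real intervals $\{Interval(x)\}_{x\in V}$, all of the same length, such that for distinct $x,y$, $xy\in E$ iff $Interval(x)\cap Interval(y)\neq\emptyset$. - Interval Ordering of a realizer: the vertices sorted by left endpoint (equivalently right endpoint) of their intervals, ties broken arbitrarily. - Consecutive Neighbourhood Ordering: for every vertex $v$, $N[v]$ occurs consecutively in the ordering. - Left-Right Ordering: for all $a<b<c$, if $ac\in E$ then $ab\in E$ and $bc\in E$. - Indifference Ordering: for all $a,b,c$ with $ab\in E$, $bc\in E$, $ac\notin E$, either $a<b<c$ or $c<b<a$. - Simplicial Elimination Ordering: for every vertex $v$, the neighbours of $v$ that precede it form a clique. Bisimplicial Elimination Ordering: both the ordering and its reverse are Simplicial Elimination Orderings. - An anchor of a UIG $G$ is a vertex $x$ such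 that some (unit length) realizer of $G$ has $Interval(x)$ as its leftmost interval. - $\mathrm{minBFS}(r)$: the visiting ordering of a Breadth First Search (with a queue) starting at $r$ in which, when a vertex is processed, its not yet discovered neighbours are put in the queue in increasing order of their degree in $G$ (remaining ties broken arbitrarily). -}

module Defs where

open import Data.Fin.Base using (Fin; _<_)
open import Data.Fin.Permutation
  using (Permutation′; _⟨$⟩ʳ_; _⟨$⟩ˡ_; _∘ₚ_; reverse)
open import Data.List.Base
  using (List; []; _∷_; [_]; _++_; _∷ʳ_; map; filter; length; allFin; tabulate)
open import Data.List.Membership.Propositional using ()
  renaming (_∈_ to _∈ˡ_; _∉_ to _∉ˡ_)
import Data.List.Relation.Unary.Sorted.TotalOrder as Sorting
open import Data.List.Relation.Unary.Unique.Propositional using (Unique)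
open import Data.Nat.Base as ℕ using (ℕ; _⊔_)
import Data.Nat.Properties as ℕ
open import Data.Product.Base using (_×_; _,_; ∃-syntax)
open import Data.Rational.Base as ℚ using (ℚ; 0ℚ; ½; ∣_∣)
import Data.Rational.Properties as ℚ
open import Data.Rational.Solver using (module +-*-Solver)
open import Data.Sum.Base using (_⊎_)
open import Function.Bundles using (_⇔_)
open import Level using (0ℓ)
open import Relation.Binary.Construct.Closure.ReflexiveTransitive using (Star)
open import Relation.Binary.Core using (Rel)
open import Relation.Binary.Definitions using (Decidable; Irreflexive; Symmetric)
open import Relation.Binary.PropositionalEquality using (_≡_; _≢_; refl; cong)
open import Relation.Nullary.Negation using (¬_)
open import Relation.Unary using (Pred; _∈_; _∪_; _∖_; _≐_; ｛_｝)

-- Cauchy sequences of rationals.  Two sequences denote the same real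
-- when they are related by _≃_.

record ℝ : Set where
  field
    seq    : ℕ → ℚ
    cauchy : ∀ ε → 0ℚ ℚ.< ε →
             ∃[ N ] (∀ i j → N ℕ.≤ i → N ℕ.≤ j → ∣ seq i ℚ.- seq j ∣ ℚ.< ε)

open ℝ public

infix  4 _≤ᴿ_ _≃_
infixl 6 _-ᴿ_

_≤ᴿ_ : Rel ℝ 0ℓ
x ≤ᴿ y = ∀ ε → 0ℚ ℚ.< ε →
         ∃[ N ] (∀ i → N ℕ.≤ i → seq x i ℚ.≤ seq y i ℚ.+ ε)

_≃_ : Rel ℝ 0ℓ
x ≃ y = x ≤ᴿ y × y ≤ᴿ x

private
  halves : ∀ ε → ½ ℚ.* ε ℚ.+ ½ ℚ.* ε ≡ ε
  halves = solve 1 (λ ε → con ½ :* ε :+ con ½ :* ε := ε) refl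
    where open +-*-Solver

  ½*-positive : ∀ {ε} → 0ℚ ℚ.< ε → 0ℚ ℚ.< ½ ℚ.* ε
  ½*-positive = ℚ.*-monoʳ-<-pos ½

  interchange : ∀ a b c d → (a ℚ.- b) ℚ.- (c ℚ.- d) ≡ (a ℚ.- c) ℚ.- (b ℚ.- d)
  interchange = solve 4
    (λ a b c d → (a :- b) :- (c :- d) := (a :- c) :- (b :- d)) refl
    where open +-*-Solver

_-ᴿ_ : ℝ → ℝ → ℝ
seq    (x -ᴿ y) i    = seq x i ℚ.- seq y i
cauchy (x -ᴿ y) ε 0<ε
  with M , x-cauchy ← cauchy x (½ ℚ.* ε) (½*-positive 0<ε)
     | N , y-cauchy ← cauchy y (½ ℚ.* ε) (½*-positive 0<ε)
  = M ⊔ N , λ i j M⊔N≤i M⊔N≤j → begin-strict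
    ∣ (seq x i ℚ.- seq y i) ℚ.- (seq x j ℚ.- seq y j) ∣
      ≡⟨ cong ∣_∣ (interchange (seq x i) (seq y i) (seq x j) (seq y j)) ⟩
    ∣ (seq x i ℚ.- seq x j) ℚ.- (seq y i ℚ.- seq y j) ∣
      ≤⟨ ℚ.∣p-q∣≤∣p∣+∣q∣ (seq x i ℚ.- seq x j) (seq y i ℚ.- seq y j) ⟩
    ∣ seq x i ℚ.- seq x j ∣ ℚ.+ ∣ seq y i ℚ.- seq y j ∣
      <⟨ ℚ.+-mono-<
           (x-cauchy i j (ℕ.m⊔n≤o⇒m≤o M N M⊔N≤i) (ℕ.m⊔n≤o⇒m≤o M N M⊔N≤j))
           (y-cauchy i j (ℕ.m⊔n≤o⇒n≤o M N M⊔N≤i) (ℕ.m⊔n≤o⇒n≤o M N M⊔N≤j)) ⟩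
    ½ ℚ.* ε ℚ.+ ½ ℚ.* ε
      ≡⟨ halves ε ⟩
    ε ∎
  where open ℚ.≤-Reasoning

record Interval : Set where
  field
    left right : ℝ
    left≤right : left ≤ᴿ right

open Interval public

width : Interval → ℝ
width I = right I -ᴿ left I

points : Interval → Pred ℝ 0ℓ
points I z = left I ≤ᴿ z × z ≤ᴿ right I

Intersects : Rel Interval 0ℓ
Intersects I J = ∃[ z ] (z ∈ points I × z ∈ points J)

record Graph (n : ℕ) : Set₁ where
  infix 4 _~_ _~?_
  field
    _~_     : Rel (Fin n) 0ℓ
    _~?_    : Decidable _~_
    ~-sym   : Symmetric _~_
    ~-irrefl : Irreflexive _≡_ _~_

-- σ ⟨$⟩ʳ v is the position of the vertex v, and σ ⟨$⟩ˡ i is the vertex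
-- at position i.
Ordering : ℕ → Set
Ordering n = Permutation′ n

infix 4 _<[_]_

_<[_]_ : ∀ {n} → Fin n → Ordering n → Fin n → Set
x <[ σ ] y = σ ⟨$⟩ʳ x < σ ⟨$⟩ʳ y

reversed : ∀ {n} → Ordering n → Ordering n
reversed σ = σ ∘ₚ reverse

vertexList : ∀ {n} → Ordering n → List (Fin n)
vertexList σ = tabulate (σ ⟨$⟩ˡ_)

Consecutive : ∀ {n} → Ordering n → Pred (Fin n) 0ℓ → Set
Consecutive σ P =
  ∀ {a b c} → a <[ σ ] b → b <[ σ ] c → a ∈ P → c ∈ P → b ∈ P

module _ {n : ℕ} (G : Graph n) where
  open Graph G

  Connected : Set
  Connected = ∀ x y → Star _~_ x y

  N : Fin n → Pred (Fin n) 0ℓ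
  N v = v ~_

  N[_] : Fin n → Pred (Fin n) 0ℓ
  N[ v ] = N v ∪ ｛ v ｝

  degree : Fin n → ℕ
  degree v = length (filter (v ~?_) (allFin n))

  Clique : Pred (Fin n) 0ℓ → Set
  Clique P = ∀ {x y} → x ∈ P → y ∈ P → x ≢ y → x ~ y

  TrueTwins : Rel (Fin n) 0ℓ
  TrueTwins x y = x ~ y × N x ∖ ｛ y ｝ ≐ N y ∖ ｛ x ｝

  record Realizer : Set where
    field
      interval  : Fin n → Interval
      sameWidth : ∀ x y → width (interval x) ≃ width (interval y)
      realizes  : ∀ {x y} → x ≢ y →
                  x ~ y ⇔ Intersects (interval x) (interval y)

  open Realizer public

  UnitInterval : Set
  UnitInterval = Realizer

  Anchor : Pred (Fin n) 0ℓ
  Anchor r = ∃[ R ] (∀ y → left (interval R r) ≤ᴿ left (interval R y))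

  -- A state consists of the vertices processed so far, in order, and
  -- the queue; a vertex is discovered once it is in either list.
  State : Set
  State = List (Fin n) × List (Fin n)

  Undiscovered : State → Pred (Fin n) 0ℓ
  Undiscovered (done , queue) x = x ∉ˡ done ++ queue

  data _⟶_ : Rel State 0ℓ where
    process : ∀ {done v queue new} →
      Unique new →
      (∀ x → x ∈ˡ new ⇔ (v ~ x × x ∈ Undiscovered (done , v ∷ queue))) →
      Sorting.Sorted ℕ.≤-totalOrder (map degree new) →
      (done , v ∷ queue) ⟶ (done ∷ʳ v , queue ++ new)

  MinBFS : Fin n → Ordering n → Set
  MinBFS r σ = Star _⟶_ ([] , [ r ]) (vertexList σ , [])

  IntervalOrderingOf : Realizer → Ordering n → Set
  IntervalOrderingOf R σ =
    ∀ {x y} → x <[ σ ] y → left (interval R x) ≤ᴿ left (interval R y)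

  ConsecutiveNeighbourhood : Ordering n → Set
  ConsecutiveNeighbourhood σ = ∀ v → Consecutive σ N[ v ]

  LeftRight : Ordering n → Set
  LeftRight σ =
    ∀ {a b c} → a <[ σ ] b → b <[ σ ] c → a ~ c → a ~ b × b ~ c

  -- Without a ≢ c, the case a ≡ c would exclude every edge.
  Indifference : Ordering n → Set
  Indifference σ =
    ∀ {a b c} → a ≢ c → a ~ b → b ~ c → ¬ (a ~ c) →
    (a <[ σ ] b × b <[ σ ] c) ⊎ (c <[ σ ] b × b <[ σ ] a)

  SimplicialElimination : Ordering n → Set
  SimplicialElimination σ = ∀ v → Clique (λ x → x ∈ N v × x <[ σ ] v)

  BisimplicialElimination : Ordering n → Set
  BisimplicialElimination σ =
    SimplicialElimination σ × SimplicialElimination (reversed σ)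

  data CanonicalOrdering (σ : Ordering n) : Set where
    intervalOrdering         : ∀ R → IntervalOrderingOf R σ → CanonicalOrdering σ
    consecutiveNeighbourhood : ConsecutiveNeighbourhood σ → CanonicalOrdering σ
    leftRight                : LeftRight σ → CanonicalOrdering σ
    minBFS                   : ∀ r → Anchor r → MinBFS r σ → CanonicalOrdering σ
    indifference             : Indifference σ → CanonicalOrdering σ
    bisimplicialElimination  : BisimplicialElimination σ → CanonicalOrdering σ

  EqualUpToTwins : Rel (Ordering n) 0ℓ
  EqualUpToTwins σ τ = ∃[ π ]
    ((∀ v → π ⟨$⟩ʳ v ≡ v ⊎ TrueTwins (π ⟨$⟩ʳ v) v) ×
     (∀ v → σ ⟨$⟩ʳ v ≡ τ ⟨$⟩ʳ (π ⟨$⟩ʳ v)))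

  EqualUpToReversalAndTwins : Rel (Ordering n) 0ℓ
  EqualUpToReversalAndTwins σ τ =
    EqualUpToTwins σ τ ⊎ EqualUpToTwins σ (reversed τ)

{-# OPTIONS --safe #-}
module Submission where

-- Each of the six kinds of ordering has the umbrella property: if
-- a ≤ b ≤ c and c is in the closed neighbourhood of a, then b is in the
-- closed neighbourhoods of both.  For (5) and (6) this uses connectivity:
-- induced paths are monotone, and a monotone path from b to a cannot avoid
-- the neighbours of a and c.  For (4), in BFS from the leftmost vertex every
-- discovered vertex lies left of every undiscovered one, and the vertices
-- discovered together have nested neighbourhoods, so that sorting them by
-- degree sorts them by left endpoint up to twins.
--
-- Two umbrella orderings agree up to reversal on the edges joining non-twins:
-- an induced path on three vertices is monotone in both, a triangle is
-- reduced to such paths by a vertex separating two of its corners, and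
-- connectivity spreads the orientation.  Monotone paths extend the agreement
-- to all pairs of non-twins, and counting initial segments then shows that
-- equal positions hold equal or twin vertices.

open import Defs
open import Data.Fin.Base as F using (Fin; toℕ; fromℕ<; inject≤)
import Data.Fin.Properties as F
open import Data.Fin.Permutation
  using (_⟨$⟩ʳ_; _⟨$⟩ˡ_; _∘ₚ_; flip; inverseˡ; inverseʳ)
open import Data.List.Base
  using (List; []; _∷_; [_]; _++_; _∷ʳ_; map; filter; length; allFin; tabulate)
open import Data.List.Membership.Propositional using () renaming (_∈_ to _∈ˡ_; _∉_ to _∉ˡ_)
open import Data.List.Membership.Propositional.Properties
  using (∈-++⁺ˡ; ∈-++⁺ʳ; ∈-++⁻; ∈-∃++; ∈-filter⁺; ∈-filter⁻; ∈-allFin)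
import Data.List.Membership.DecPropositional as DecMembership
open import Data.List.Properties using (++-assoc; ++-identityʳ; ∷ʳ-++; length-++-sucʳ)
open import Data.List.Relation.Unary.All as All using (All; []; _∷_)
import Data.List.Relation.Unary.All.Properties as All
open import Data.List.Relation.Unary.AllPairs using (AllPairs; []; _∷_)
import Data.List.Relation.Unary.AllPairs.Properties as AllPairs
open import Data.List.Relation.Unary.Any using (here; there)
open import Data.List.Relation.Unary.Sorted.TotalOrder.Properties using (Sorted⇒AllPairs)
open import Data.List.Relation.Unary.Unique.Propositional using (Unique)
import Data.List.Relation.Unary.Unique.Propositional.Properties as Unique
open import Data.Nat.Base as ℕ using (ℕ; suc; s≤s; z≤n; _⊔_)
import Data.Nat.Properties as ℕ
open import Data.Product.Base using (_×_; _,_; proj₁; proj₂; ∃-syntax; swap)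
open import Data.Rational.Base as ℚ using (ℚ; 0ℚ; ½; ∣_∣)
import Data.Rational.Properties as ℚ
open import Data.Rational.Solver using (module +-*-Solver)
open import Data.Sum.Base as Sum using (_⊎_; inj₁; inj₂; [_,_]′)
open import Effect.Monad using (RawMonad)
open import Function.Base using (_∘_; id)
open import Function.Bundles using (Equivalence; Injection)
open import Function.Properties.Inverse using (↔⇒↣)
open import Level using (0ℓ)
open import Relation.Binary.Construct.Closure.ReflexiveTransitive using (Star; _◅_)
open import Relation.Binary.Core using (Rel)
open import Relation.Binary.Definitions
  using (Reflexive; Symmetric; Transitive; Decidable; Total; tri<; tri≈; tri>)
open import Relation.Binary.PropositionalEquality
  using (_≡_; _≢_; refl; sym; trans; cong; subst; subst₂; module ≡-Reasoning)
open import Relation.Nullary.Decidable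
  using (yes; no; _×-dec_; _→-dec_; _⊎-dec_; ¬?; decidable-stable)
open import Relation.Nullary.Negation using (¬_; contradiction; ¬¬-Monad)

-- The order on Cauchy reals, constructively.

½*-pos : ∀ {ε} → 0ℚ ℚ.< ε → 0ℚ ℚ.< ½ ℚ.* ε
½*-pos = ℚ.*-monoʳ-<-pos ½

+-½-½ : ∀ p ε → p ℚ.+ ½ ℚ.* ε ℚ.+ ½ ℚ.* ε ≡ p ℚ.+ ε
+-½-½ = solve 2 (λ p ε → p :+ con ½ :* ε :+ con ½ :* ε := p :+ ε) refl
  where open +-*-Solver

p≤p+ε : ∀ p {ε} → 0ℚ ℚ.< ε → p ℚ.≤ p ℚ.+ ε
p≤p+ε p {ε} 0<ε = subst (ℚ._≤ p ℚ.+ ε) (ℚ.+-identityʳ p) (ℚ.+-monoʳ-≤ p (ℚ.<⇒≤ 0<ε))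

p≤∣p∣ : ∀ p → p ℚ.≤ ∣ p ∣
p≤∣p∣ p with ℚ.≤-total 0ℚ p
... | inj₁ 0≤p = ℚ.≤-reflexive (sym (ℚ.0≤p⇒∣p∣≡p 0≤p))
... | inj₂ p≤0 = ℚ.≤-trans p≤0 (ℚ.0≤∣p∣ p)

∣p-q∣<ε⇒p≤q+ε : ∀ p q {ε} → ∣ p ℚ.- q ∣ ℚ.< ε → p ℚ.≤ q ℚ.+ ε
∣p-q∣<ε⇒p≤q+ε p q {ε} <ε = begin
  p                 ≡⟨ solve 2 (λ p q → p := q :+ (p :- q)) refl p q ⟩
  q ℚ.+ (p ℚ.- q)   ≤⟨ ℚ.+-monoʳ-≤ q (p≤∣p∣ (p ℚ.- q)) ⟩
  q ℚ.+ ∣ p ℚ.- q ∣ ≤⟨ ℚ.+-monoʳ-≤ q (ℚ.<⇒≤ <ε) ⟩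
  q ℚ.+ ε           ∎
  where open ℚ.≤-Reasoning ; open +-*-Solver

+-cancelʳ-≤ : ∀ r {p q} → p ℚ.+ r ℚ.≤ q ℚ.+ r → p ℚ.≤ q
+-cancelʳ-≤ r {p} {q} p+r≤q+r = subst₂ ℚ._≤_ (cancel p r) (cancel q r) (ℚ.+-monoˡ-≤ (ℚ.- r) p+r≤q+r)
  where
  open +-*-Solver
  cancel : ∀ p r → p ℚ.+ r ℚ.+ ℚ.- r ≡ p
  cancel = solve 2 (λ p r → p :+ r :+ :- r := p) refl

≤ᴿ-refl : ∀ x → x ≤ᴿ x
≤ᴿ-refl x ε 0<ε = 0 , λ i _ → p≤p+ε (seq x i) 0<ε

≤ᴿ-trans : ∀ x y z → x ≤ᴿ y → y ≤ᴿ z → x ≤ᴿ z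
≤ᴿ-trans x y z x≤y y≤z ε 0<ε
  with M , x≤y ← x≤y (½ ℚ.* ε) (½*-pos 0<ε)
     | N , y≤z ← y≤z (½ ℚ.* ε) (½*-pos 0<ε)
  = M ⊔ N , λ i M⊔N≤i → begin
    seq x i                           ≤⟨ x≤y i (ℕ.m⊔n≤o⇒m≤o M N M⊔N≤i) ⟩
    seq y i ℚ.+ ½ ℚ.* ε               ≤⟨ ℚ.+-monoˡ-≤ _ (y≤z i (ℕ.m⊔n≤o⇒n≤o M N M⊔N≤i)) ⟩
    seq z i ℚ.+ ½ ℚ.* ε ℚ.+ ½ ℚ.* ε   ≡⟨ +-½-½ (seq z i) ε ⟩
    seq z i ℚ.+ ε                     ∎
  where open ℚ.≤-Reasoning

-- A right endpoint is the left endpoint plus the width, so among intervals of equal width the order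
-- of left endpoints carries over to right endpoints.
≤ᴿ-width : ∀ I J → width I ≤ᴿ width J → left I ≤ᴿ left J → right I ≤ᴿ right J
≤ᴿ-width I J w≤ l≤ ε 0<ε
  with M , w≤ ← w≤ (½ ℚ.* ε) (½*-pos 0<ε)
     | N , l≤ ← l≤ (½ ℚ.* ε) (½*-pos 0<ε)
  = M ⊔ N , λ i M⊔N≤i →
    let a = seq (left I) i ; b = seq (right I) i
        c = seq (left J) i ; d = seq (right J) i in begin
    b                                               ≡⟨ solve 2 (λ a b → b := (b :- a) :+ a) refl a b ⟩
    (b ℚ.- a) ℚ.+ a                                 ≤⟨ ℚ.+-mono-≤ (w≤ i (ℕ.m⊔n≤o⇒m≤o M N M⊔N≤i))
                                                                 (l≤ i (ℕ.m⊔n≤o⇒n≤o M N M⊔N≤i)) ⟩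
    (d ℚ.- c ℚ.+ ½ ℚ.* ε) ℚ.+ (c ℚ.+ ½ ℚ.* ε)       ≡⟨ solve 3 (λ c d ε →
                                                         (d :- c :+ con ½ :* ε) :+ (c :+ con ½ :* ε)
                                                         := d :+ ε) refl c d ε ⟩
    d ℚ.+ ε                                         ∎
  where open ℚ.≤-Reasoning ; open +-*-Solver

cauchy-≤ : ∀ x ε → 0ℚ ℚ.< ε →
           ∃[ N ] (∀ i j → N ℕ.≤ i → N ℕ.≤ j → seq x i ℚ.≤ seq x j ℚ.+ ε)
cauchy-≤ x ε 0<ε with N , close ← cauchy x ε 0<ε =
  N , λ i j N≤i N≤j → ∣p-q∣<ε⇒p≤q+ε (seq x i) (seq x j) (close i j N≤i N≤j)

-- From some `K` on, both sequences stay within `δ` of their values at `K`, so one decidable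
-- comparison of `seq y K` with `seq x K ℚ.+ δ ℚ.+ δ` settles the matter. Below that bound, passing
-- from `K` to `i` costs two further `δ`; above it, the gap of two `δ` absorbs both errors and
-- yields `x ≤ᴿ y`.
≰ᴿ⇒≥+4δ : ∀ x y → ¬ x ≤ᴿ y → ∀ δ → 0ℚ ℚ.< δ →
          ∃[ K ] (∀ i → K ℕ.≤ i → seq y i ℚ.≤ seq x i ℚ.+ δ ℚ.+ δ ℚ.+ δ ℚ.+ δ)
≰ᴿ⇒≥+4δ x y x≰y δ 0<δ =
  let M , x-close = cauchy-≤ x δ 0<δ
      N , y-close = cauchy-≤ y δ 0<δ
  in compare (M ⊔ N)
       (λ i j K≤i K≤j → x-close i j (ℕ.m⊔n≤o⇒m≤o M N K≤i) (ℕ.m⊔n≤o⇒m≤o M N K≤j))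
       (λ i j K≤i K≤j → y-close i j (ℕ.m⊔n≤o⇒n≤o M N K≤i) (ℕ.m⊔n≤o⇒n≤o M N K≤j))
  where
  open ℚ.≤-Reasoning

  +δ : ∀ p q → p ℚ.≤ q → p ℚ.+ δ ℚ.≤ q ℚ.+ δ
  +δ p q = ℚ.+-monoˡ-≤ δ {p} {q}

  -δ : ∀ p q → p ℚ.+ δ ℚ.≤ q ℚ.+ δ → p ℚ.≤ q
  -δ p q = +-cancelʳ-≤ δ {p} {q}

  compare : ∀ K →
            (∀ i j → K ℕ.≤ i → K ℕ.≤ j → seq x i ℚ.≤ seq x j ℚ.+ δ) →
            (∀ i j → K ℕ.≤ i → K ℕ.≤ j → seq y i ℚ.≤ seq y j ℚ.+ δ) →
            ∃[ N ] (∀ i → N ℕ.≤ i → seq y i ℚ.≤ seq x i ℚ.+ δ ℚ.+ δ ℚ.+ δ ℚ.+ δ)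
  compare K x-close y-close = [ below , above ]′ (ℚ.≤-total (seq y K) (seq x K ℚ.+ δ ℚ.+ δ))
    where
    below : seq y K ℚ.≤ seq x K ℚ.+ δ ℚ.+ δ →
            ∃[ N ] (∀ i → N ℕ.≤ i → seq y i ℚ.≤ seq x i ℚ.+ δ ℚ.+ δ ℚ.+ δ ℚ.+ δ)
    below y≤x = K , λ i K≤i → begin
      seq y i                         ≤⟨ y-close i K K≤i ℕ.≤-refl ⟩
      seq y K ℚ.+ δ                   ≤⟨ +δ (seq y K) (seq x K ℚ.+ δ ℚ.+ δ) y≤x ⟩
      seq x K ℚ.+ δ ℚ.+ δ ℚ.+ δ       ≤⟨ +δ (seq x K ℚ.+ δ ℚ.+ δ) (seq x i ℚ.+ δ ℚ.+ δ ℚ.+ δ)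
                                           (+δ (seq x K ℚ.+ δ) (seq x i ℚ.+ δ ℚ.+ δ)
                                             (+δ (seq x K) (seq x i ℚ.+ δ)
                                               (x-close K i ℕ.≤-refl K≤i))) ⟩
      seq x i ℚ.+ δ ℚ.+ δ ℚ.+ δ ℚ.+ δ ∎

    above : seq x K ℚ.+ δ ℚ.+ δ ℚ.≤ seq y K →
            ∃[ N ] (∀ i → N ℕ.≤ i → seq y i ℚ.≤ seq x i ℚ.+ δ ℚ.+ δ ℚ.+ δ ℚ.+ δ)
    above x+2δ≤y = contradiction x≤y x≰y
      where
      x≤y : x ≤ᴿ y
      x≤y ε 0<ε = K , λ i K≤i → ℚ.≤-trans {seq x i} {seq y i} (-δ (seq x i) (seq y i) (begin
        seq x i ℚ.+ δ             ≤⟨ +δ (seq x i) (seq x K ℚ.+ δ) (x-close i K K≤i ℕ.≤-refl) ⟩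
        seq x K ℚ.+ δ ℚ.+ δ       ≤⟨ x+2δ≤y ⟩
        seq y K                   ≤⟨ y-close K i ℕ.≤-refl K≤i ⟩
        seq y i ℚ.+ δ             ∎)) (p≤p+ε (seq y i) {ε} 0<ε)

≰ᴿ⇒≥ : ∀ x y → ¬ x ≤ᴿ y → y ≤ᴿ x
≰ᴿ⇒≥ x y x≰y ε 0<ε =
  let K , y≤x = ≰ᴿ⇒≥+4δ x y x≰y ε/4 (½*-pos {ε/2} (½*-pos {ε} 0<ε))
  in K , λ i K≤i → subst (seq y i ℚ.≤_) (quarters (seq x i)) (y≤x i K≤i)
  where
  open ≡-Reasoning

  ε/2 ε/4 : ℚ
  ε/2 = ½ ℚ.* ε
  ε/4 = ½ ℚ.* ε/2

  quarters : ∀ p → p ℚ.+ ε/4 ℚ.+ ε/4 ℚ.+ ε/4 ℚ.+ ε/4 ≡ p ℚ.+ ε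
  quarters p = begin
    p ℚ.+ ε/4 ℚ.+ ε/4 ℚ.+ ε/4 ℚ.+ ε/4 ≡⟨ +-½-½ (p ℚ.+ ε/4 ℚ.+ ε/4) ε/2 ⟩
    p ℚ.+ ε/4 ℚ.+ ε/4 ℚ.+ ε/2         ≡⟨ cong (ℚ._+ ε/2) (+-½-½ p ε/2) ⟩
    p ℚ.+ ε/2 ℚ.+ ε/2                 ≡⟨ +-½-½ p ε ⟩
    p ℚ.+ ε                           ∎

-- Reals cannot be compared by a case split; the doubly negated form still serves any decidable
-- goal.
≤ᴿ-¬¬total : ∀ x y → ¬ ¬ (x ≤ᴿ y ⊎ y ≤ᴿ x)
≤ᴿ-¬¬total x y ¬total = ¬total (inj₂ (≰ᴿ⇒≥ x y (¬total ∘ inj₁)))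

-- Positions, lists and reversal.

infix 4 _≤[_]_

_≤[_]_ : ∀ {n} → Fin n → Ordering n → Fin n → Set
x ≤[ σ ] y = σ ⟨$⟩ʳ x F.≤ σ ⟨$⟩ʳ y

module _ {a} {A : Set a} where

  unique-⊆⇒length≤ : ∀ {xs ys : List A} → Unique xs → (∀ {x} → x ∈ˡ xs → x ∈ˡ ys) →
                     length xs ℕ.≤ length ys
  unique-⊆⇒length≤ [] _ = z≤n
  unique-⊆⇒length≤ {x ∷ xs} {ys} (x∉xs ∷ xs!) xs⊆ys with as , bs , refl ← ∈-∃++ (xs⊆ys (here refl)) =
    ℕ.≤-trans (s≤s (unique-⊆⇒length≤ xs! xs⊆as++bs)) (ℕ.≤-reflexive (sym (length-++-sucʳ as x bs)))
    where
    xs⊆as++bs : ∀ {y} → y ∈ˡ xs → y ∈ˡ as ++ bs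
    xs⊆as++bs y∈xs with ∈-++⁻ as (xs⊆ys (there y∈xs))
    ... | inj₁ y∈as         = ∈-++⁺ˡ y∈as
    ... | inj₂ (here refl)  = contradiction refl (All.lookup x∉xs y∈xs)
    ... | inj₂ (there y∈bs) = ∈-++⁺ʳ as y∈bs

  allPairs-∈ : ∀ {r s} {R : Rel A r} {S : Rel A s} {xs} →
               (∀ {x y} → x ∈ˡ xs → y ∈ˡ xs → R x y → S x y) → AllPairs R xs → AllPairs S xs
  allPairs-∈ f []         = []
  allPairs-∈ f (px ∷ pxs) =
    All.tabulate (λ y∈xs → f (here refl) (there y∈xs) (All.lookup px y∈xs)) ∷
    allPairs-∈ (λ x∈xs y∈xs → f (there x∈xs) (there y∈xs)) pxs

  allPairs-++-∷ : ∀ {r} {R : Rel A r} xs {y ys} → AllPairs R (xs ++ y ∷ ys) → All (R y) ys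
  allPairs-++-∷ []       (py ∷ _)  = py
  allPairs-++-∷ (_ ∷ xs) (_ ∷ pxs) = allPairs-++-∷ xs pxs

  allPairs-tabulate⁻ : ∀ {r} {R : Rel A r} {n} {f : Fin n → A} →
                       AllPairs R (tabulate f) → ∀ {i j} → i F.< j → R (f i) (f j)
  allPairs-tabulate⁻ (pf ∷ _)  {F.zero}  {F.suc j} _         = All.tabulate⁻ pf j
  allPairs-tabulate⁻ (_ ∷ pfs) {F.suc i} {F.suc j} (s≤s i<j) = allPairs-tabulate⁻ pfs i<j

module _ {n : ℕ} (σ : Ordering n) where

  position-injective : ∀ {x y} → σ ⟨$⟩ʳ x ≡ σ ⟨$⟩ʳ y → x ≡ y
  position-injective = Injection.injective (↔⇒↣ σ)

  order-cmp : ∀ x y → x <[ σ ] y ⊎ x ≡ y ⊎ y <[ σ ] x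
  order-cmp x y with F.<-cmp (σ ⟨$⟩ʳ x) (σ ⟨$⟩ʳ y)
  ... | tri< x<y _ _ = inj₁ x<y
  ... | tri≈ _ x≡y _ = inj₂ (inj₁ (position-injective x≡y))
  ... | tri> _ _ y<x = inj₂ (inj₂ y<x)

  order-total : ∀ x y → x ≤[ σ ] y ⊎ y ≤[ σ ] x
  order-total x y = F.≤-total (σ ⟨$⟩ʳ x) (σ ⟨$⟩ʳ y)

  <⇒≢-order : ∀ {x y} → x <[ σ ] y → x ≢ y
  <⇒≢-order x<y refl = ℕ.<-irrefl refl x<y

  reversed-≤ : ∀ {x y} → x ≤[ σ ] y → y ≤[ reversed σ ] x
  reversed-≤ {x} {y} x≤y
    rewrite F.opposite-prop (σ ⟨$⟩ʳ x) | F.opposite-prop (σ ⟨$⟩ʳ y)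
    = ℕ.∸-monoʳ-≤ n (s≤s x≤y)

  reversed-< : ∀ {x y} → x <[ σ ] y → y <[ reversed σ ] x
  reversed-< {x} {y} x<y
    rewrite F.opposite-prop (σ ⟨$⟩ʳ x) | F.opposite-prop (σ ⟨$⟩ʳ y)
    = ℕ.∸-monoʳ-< (s≤s x<y) (F.toℕ<n (σ ⟨$⟩ʳ y))

  reversed-≤⁻ : ∀ {x y} → x ≤[ reversed σ ] y → y ≤[ σ ] x
  reversed-≤⁻ {x} {y} x≤y with order-cmp x y
  ... | inj₁ x<y        = contradiction (reversed-< x<y) (ℕ.≤⇒≯ x≤y)
  ... | inj₂ (inj₁ refl) = ℕ.≤-refl
  ... | inj₂ (inj₂ y<x) = ℕ.<⇒≤ y<x

  reversed-<⁻ : ∀ {x y} → x <[ reversed σ ] y → y <[ σ ] x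
  reversed-<⁻ {x} {y} x<y with order-cmp y x
  ... | inj₁ y<x         = y<x
  ... | inj₂ (inj₁ refl) = contradiction x<y (ℕ.<-irrefl refl)
  ... | inj₂ (inj₂ x<′y) = contradiction (reversed-< x<′y) (ℕ.<-asym x<y)

-- Closed neighbourhoods and twins.

module _ {n : ℕ} (G : Graph n) where
  open Graph G

  infix 4 _⌢_ _⌢?_ _≈_ _≈?_

  _⌢_ : Rel (Fin n) 0ℓ
  x ⌢ y = N[_] G x y

  ⌢-refl : Reflexive _⌢_
  ⌢-refl = inj₂ refl

  ⌢-sym : Symmetric _⌢_
  ⌢-sym (inj₁ x~y) = inj₁ (~-sym x~y)
  ⌢-sym (inj₂ x≡y) = inj₂ (sym x≡y)

  _⌢?_ : Decidable _⌢_
  x ⌢? y = (x ~? y) ⊎-dec (x F.≟ y)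

  ⌢⇒~ : ∀ {x y} → x ⌢ y → x ≢ y → x ~ y
  ⌢⇒~ (inj₁ x~y) _   = x~y
  ⌢⇒~ (inj₂ x≡y) x≢y = contradiction x≡y x≢y

  -- Equal or true twins.
  _≈_ : Rel (Fin n) 0ℓ
  x ≈ y = ∀ w → (x ⌢ w → y ⌢ w) × (y ⌢ w → x ⌢ w)

  _≈?_ : Decidable _≈_
  x ≈? y = F.all? λ w →
    ((x ⌢? w) →-dec (y ⌢? w)) ×-dec ((y ⌢? w) →-dec (x ⌢? w))

  ≈-refl : Reflexive _≈_
  ≈-refl w = id , id

  ≈-sym : Symmetric _≈_
  ≈-sym x≈y w = swap (x≈y w)

  ≈-trans : Transitive _≈_
  ≈-trans x≈y y≈z w =
    proj₁ (y≈z w) ∘ proj₁ (x≈y w) , proj₂ (x≈y w) ∘ proj₂ (y≈z w)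

  ≈⇒⌢ : ∀ {x y} → x ≈ y → x ⌢ y
  ≈⇒⌢ {y = y} x≈y = proj₂ (x≈y y) ⌢-refl

  ≈⇒≡⊎twins : ∀ {x y} → x ≈ y → x ≡ y ⊎ TrueTwins G x y
  ≈⇒≡⊎twins {x} {y} x≈y with x F.≟ y
  ... | yes x≡y = inj₁ x≡y
  ... | no  x≢y = inj₂
    ( ⌢⇒~ (≈⇒⌢ x≈y) x≢y
    , (λ (x~w , y≢w) → ⌢⇒~ (proj₁ (x≈y _) (inj₁ x~w)) y≢w , λ x≡w → ~-irrefl x≡w x~w)
    , (λ (y~w , x≢w) → ⌢⇒~ (proj₂ (x≈y _) (inj₁ y~w)) x≢w , λ y≡w → ~-irrefl y≡w y~w)
    )

  separated : ∀ {x y w} → x ⌢ w → ¬ y ⌢ w → ¬ x ≈ y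
  separated x⌢w y¬⌢w x≈y = y¬⌢w (proj₁ (x≈y _) x⌢w)

  separator : ∀ {x y} → ¬ x ≈ y →
              ∃[ w ] ((x ⌢ w × ¬ y ⌢ w) ⊎ (y ⌢ w × ¬ x ⌢ w))
  separator {x} {y} x≉y
    with w , differ ← F.¬∀⟶∃¬ n _
           (λ w → ((x ⌢? w) →-dec (y ⌢? w)) ×-dec ((y ⌢? w) →-dec (x ⌢? w))) x≉y
    with x ⌢? w | y ⌢? w
  ... | yes x⌢w | no y¬⌢w = w , inj₁ (x⌢w , y¬⌢w)
  ... | no x¬⌢w | yes y⌢w = w , inj₂ (y⌢w , x¬⌢w)
  ... | yes x⌢w | yes y⌢w = contradiction ((λ _ → y⌢w) , (λ _ → x⌢w)) differ
  ... | no x¬⌢w | no y¬⌢w =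
    contradiction ((λ x⌢w → contradiction x⌢w x¬⌢w) , (λ y⌢w → contradiction y⌢w y¬⌢w)) differ

  -- The umbrella property and induced paths on three vertices.

  -- Stated for an arbitrary relation, since it is applied to positions, to left endpoints, and to
  -- left endpoints up to twins.
  Umbrella : Rel (Fin n) 0ℓ → Set
  Umbrella _≼_ = ∀ {a b c} → a ≼ b → b ≼ c → a ⌢ c → a ⌢ b × b ⌢ c

  UmbrellaOrdering : Ordering n → Set
  UmbrellaOrdering σ = Umbrella (λ x y → x ≤[ σ ] y)

  Between : Ordering n → Fin n → Fin n → Fin n → Set
  Between σ a b c = (a <[ σ ] b × b <[ σ ] c) ⊎ (c <[ σ ] b × b <[ σ ] a)

  -- Closed adjacency admits no degenerate paths: `¬ a ⌢ c` already forces `a`, `b` and `c` to be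
  -- distinct.
  InducedPathsMonotone : Ordering n → Set
  InducedPathsMonotone σ =
    ∀ {a b c} → a ⌢ b → b ⌢ c → ¬ a ⌢ c → Between σ a b c

  umbrella⁺ : ∀ σ →
              (∀ {a b c} → a <[ σ ] b → b <[ σ ] c → a ~ c → a ⌢ b × b ⌢ c) →
              UmbrellaOrdering σ
  umbrella⁺ σ strict {a} {b} {c} a≤b b≤c a⌢c with order-cmp σ a b | order-cmp σ b c
  ... | inj₂ (inj₁ refl) | _                = ⌢-refl , a⌢c
  ... | inj₂ (inj₂ b<a)  | _                = contradiction b<a (ℕ.≤⇒≯ a≤b)
  ... | inj₁ _           | inj₂ (inj₁ refl) = a⌢c , ⌢-refl
  ... | inj₁ _           | inj₂ (inj₂ c<b)  = contradiction c<b (ℕ.≤⇒≯ b≤c)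
  ... | inj₁ a<b         | inj₁ b<c         =
    strict a<b b<c (⌢⇒~ a⌢c (<⇒≢-order σ (ℕ.<-trans a<b b<c)))

  umbrella-reversed : ∀ σ → UmbrellaOrdering σ → UmbrellaOrdering (reversed σ)
  umbrella-reversed σ umbrella {a} {b} {c} a≤b b≤c a⌢c
    with c⌢b , b⌢a ← umbrella {c} {b} {a} (reversed-≤⁻ σ b≤c) (reversed-≤⁻ σ a≤b) (⌢-sym a⌢c)
    = ⌢-sym b⌢a , ⌢-sym c⌢b

  -- If `b` were first or last of the three, the nearer of `a` and `c` would lie under the edge from
  -- `b` to the farther one, making `a` and `c` adjacent.
  umbrella⇒monotone : ∀ σ → UmbrellaOrdering σ → InducedPathsMonotone σ
  umbrella⇒monotone σ umbrella {a} {b} {c} a⌢b b⌢c a¬⌢c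
    with order-cmp σ a b | order-cmp σ b c
  ... | inj₂ (inj₁ refl) | _                = contradiction b⌢c a¬⌢c
  ... | _                | inj₂ (inj₁ refl) = contradiction a⌢b a¬⌢c
  ... | inj₁ a<b         | inj₁ b<c         = inj₁ (a<b , b<c)
  ... | inj₂ (inj₂ b<a)  | inj₂ (inj₂ c<b)  = inj₂ (c<b , b<a)
  ... | inj₁ a<b         | inj₂ (inj₂ c<b)  with order-total σ a c
  ...   | inj₁ a≤c = contradiction (proj₁ (umbrella {a} {c} {b} a≤c (ℕ.<⇒≤ c<b) a⌢b)) a¬⌢c
  ...   | inj₂ c≤a = contradiction (⌢-sym (proj₁ (umbrella {c} {a} {b} c≤a (ℕ.<⇒≤ a<b) (⌢-sym b⌢c)))) a¬⌢c
  umbrella⇒monotone σ umbrella {a} {b} {c} a⌢b b⌢c a¬⌢c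
      | inj₂ (inj₂ b<a)  | inj₁ b<c         with order-total σ a c
  ...   | inj₁ a≤c = contradiction (proj₂ (umbrella {b} {a} {c} (ℕ.<⇒≤ b<a) a≤c b⌢c)) a¬⌢c
  ...   | inj₂ c≤a = contradiction (⌢-sym (proj₂ (umbrella {b} {c} {a} (ℕ.<⇒≤ b<c) c≤a (⌢-sym a⌢b)))) a¬⌢c

  -- Monotone paths from connectivity.

  monotone-reversed : ∀ σ → InducedPathsMonotone σ → InducedPathsMonotone (reversed σ)
  monotone-reversed σ monotone a⌢b b⌢c a¬⌢c with monotone a⌢b b⌢c a¬⌢c
  ... | inj₁ (a<b , b<c) = inj₂ (reversed-< σ b<c , reversed-< σ a<b)
  ... | inj₂ (c<b , b<a) = inj₁ (reversed-< σ b<a , reversed-< σ c<b)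

  -- Twins are excluded because two orderings can be expected to agree only on edges between
  -- non-twins.
  Ascent : Ordering n → Rel (Fin n) 0ℓ
  Ascent σ x y = x ⌢ y × ¬ x ≈ y × x <[ σ ] y

  ascents⇒≤ : ∀ σ {x y} → Star (Ascent σ) x y → x ≤[ σ ] y
  ascents⇒≤ σ Star.ε = ℕ.≤-refl
  ascents⇒≤ σ ((_ , _ , x<q) ◅ q≤y) = ℕ.≤-trans (ℕ.<⇒≤ x<q) (ascents⇒≤ σ q≤y)

  module _ (σ : Ordering n) (monotone : InducedPathsMonotone σ) where

    -- Vertices of the path are skipped as long as the next one, `p`, is still adjacent to `x`.
    -- Otherwise `x`, `q`, `p` is an induced path, so `q <[ σ ] p` forces `x <[ σ ] q`, and `p`
    -- separates `x` from `q`.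
    shorten : ∀ {x q y} → x ⌢ q → Star (Ascent σ) q y → x ⌢ y ⊎ Star (Ascent σ) x y
    shorten x⌢q Star.ε = inj₁ x⌢q
    shorten {x} {q} x⌢q (_◅_ {j = p} step@(q⌢p , _ , q<p) p≤y) with x ⌢? p
    ... | yes x⌢p = shorten x⌢p p≤y
    ... | no x¬⌢p with monotone x⌢q q⌢p x¬⌢p
    ...   | inj₁ (x<q , _) =
      inj₂ ((x⌢q , (λ x≈q → separated q⌢p x¬⌢p (≈-sym x≈q)) , x<q) ◅ step ◅ p≤y)
    ...   | inj₂ (p<q , _) = contradiction p<q (ℕ.<-asym q<p)

  module _ (σ : Ordering n) (monotone : InducedPathsMonotone σ) where

    monotonePath : ∀ {x y} → Star _~_ x y →
                   x ⌢ y ⊎ Star (Ascent σ) x y ⊎ Star (Ascent (reversed σ)) x y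
    monotonePath Star.ε = inj₁ ⌢-refl
    monotonePath {x} {y} (_◅_ {j = q} x~q q⟶y) with monotonePath q⟶y
    ... | inj₂ (inj₁ up)   = Sum.map₂ inj₁ (shorten σ monotone (inj₁ x~q) up)
    ... | inj₂ (inj₂ down) = Sum.map₂ inj₂ (shorten (reversed σ) (monotone-reversed σ monotone) (inj₁ x~q) down)
    ... | inj₁ q⌢y with x ⌢? y
    ...   | yes x⌢y = inj₁ x⌢y
    ...   | no x¬⌢y = inj₂ (Sum.map
      (λ (x<q , q<y) → (x⌢q , x≉q , x<q) ◅ (q⌢y , q≉y , q<y) ◅ Star.ε)
      (λ (y<q , q<x) → (x⌢q , x≉q , reversed-< σ q<x) ◅ (q⌢y , q≉y , reversed-< σ y<q) ◅ Star.ε)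
      (monotone x⌢q q⌢y x¬⌢y))
      where
      x⌢q = inj₁ x~q

      x≉q : ¬ x ≈ q
      x≉q x≈q = separated q⌢y x¬⌢y (≈-sym x≈q)

      q≉y : ¬ q ≈ y
      q≉y = separated (⌢-sym x⌢q) (x¬⌢y ∘ ⌢-sym)

    -- The path enters the neighbourhood of a or c from above at a vertex p
    -- below c; then p is adjacent to both, and lies below its neighbours u
    -- and c, which are not adjacent.
    noDescent : ∀ {a c u} → a ⌢ c → ¬ u ⌢ a → ¬ u ⌢ c → a ≤[ σ ] c → u ≤[ σ ] c →
                ¬ Star (Ascent (reversed σ)) u a
    noDescent a⌢c u¬⌢a _ _ _ Star.ε = u¬⌢a ⌢-refl
    noDescent {a} {c} {u} a⌢c u¬⌢a u¬⌢c a≤c u≤c (_◅_ {j = p} (u⌢p , _ , u>p) p≥a)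
      with p ⌢? a | p ⌢? c
    ... | no p¬⌢a | no p¬⌢c = noDescent a⌢c p¬⌢a p¬⌢c a≤c p≤c p≥a
      where p≤c = ℕ.≤-trans (ℕ.<⇒≤ (reversed-<⁻ σ u>p)) u≤c
    ... | _ | yes p⌢c with monotone u⌢p p⌢c u¬⌢c
    ...   | inj₁ (u<p , _) = ℕ.<-asym u<p (reversed-<⁻ σ u>p)
    ...   | inj₂ (c<p , p<u) = ℕ.<⇒≱ (ℕ.<-trans c<p p<u) u≤c
    noDescent {a} {c} {u} a⌢c u¬⌢a u¬⌢c a≤c u≤c (_◅_ {j = p} (u⌢p , _ , u>p) p≥a)
        | yes p⌢a | no p¬⌢c with monotone p⌢a a⌢c p¬⌢c
    ...   | inj₁ (p<a , _) = ℕ.<⇒≱ p<a (reversed-≤⁻ σ (ascents⇒≤ (reversed σ) p≥a))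
    ...   | inj₂ (c<a , _) = ℕ.<⇒≱ c<a a≤c

    -- If `b` is adjacent to just one end of the edge `a c`, that end is the centre of an induced
    -- path without lying between its neighbours. If `b` is adjacent to neither, a monotone path
    -- from `b` to `a` has to descend, which `noDescent` forbids.
    monotone⇒umbrella : Connected G → UmbrellaOrdering σ
    monotone⇒umbrella connected = umbrella⁺ σ strict
      where
      strict : ∀ {a b c} → a <[ σ ] b → b <[ σ ] c → a ~ c → a ⌢ b × b ⌢ c
      strict {a} {b} {c} a<b b<c a~c with a ⌢? b | b ⌢? c
      ... | yes a⌢b | yes b⌢c = a⌢b , b⌢c
      ... | yes a⌢b | no b¬⌢c with monotone (⌢-sym a⌢b) (inj₁ a~c) b¬⌢c
      ...   | inj₁ (b<a , _) = contradiction b<a (ℕ.<-asym a<b)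
      ...   | inj₂ (c<a , _) = contradiction c<a (ℕ.<-asym (ℕ.<-trans a<b b<c))
      strict {a} {b} {c} a<b b<c a~c | no a¬⌢b | yes b⌢c with monotone (inj₁ a~c) (⌢-sym b⌢c) a¬⌢b
      ...   | inj₁ (_ , c<b) = contradiction c<b (ℕ.<-asym b<c)
      ...   | inj₂ (_ , c<a) = contradiction c<a (ℕ.<-asym (ℕ.<-trans a<b b<c))
      strict {a} {b} {c} a<b b<c a~c | no a¬⌢b | no b¬⌢c with monotonePath (connected b a)
      ... | inj₁ b⌢a = contradiction (⌢-sym b⌢a) a¬⌢b
      ... | inj₂ (inj₁ up) = contradiction (ascents⇒≤ σ up) (ℕ.<⇒≱ a<b)
      ... | inj₂ (inj₂ down) = contradiction down
        (noDescent (inj₁ a~c) (a¬⌢b ∘ ⌢-sym) b¬⌢c (ℕ.<⇒≤ (ℕ.<-trans a<b b<c)) (ℕ.<⇒≤ b<c))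

  -- A neighbour of `y` from `z` on, or up to `x`, gives an edge spanning that end; a vertex between
  -- `x` and `z` lies under the edge `x z`. Conversely, a neighbour of the twins is joined across
  -- `y` to one of them.
  ≈-convex : ∀ σ → UmbrellaOrdering σ → ∀ {x y z} →
             x ≤[ σ ] y → y ≤[ σ ] z → x ≈ z → y ≈ z
  ≈-convex σ umbrella {x} {y} {z} x≤y y≤z x≈z w = y⇒z , z⇒y
    where
    y⇒z : y ⌢ w → z ⌢ w
    y⇒z y⌢w with order-total σ z w | order-total σ x w
    ... | inj₁ z≤w | _        = proj₂ (umbrella {y} {z} {w} y≤z z≤w y⌢w)
    ... | inj₂ w≤z | inj₁ x≤w = ⌢-sym (proj₂ (umbrella {x} {w} {z} x≤w w≤z (≈⇒⌢ x≈z)))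
    ... | inj₂ _   | inj₂ w≤x =
      proj₁ (x≈z w) (⌢-sym (proj₁ (umbrella {w} {x} {y} w≤x x≤y (⌢-sym y⌢w))))

    z⇒y : z ⌢ w → y ⌢ w
    z⇒y z⌢w with order-total σ y w
    ... | inj₁ y≤w = proj₂ (umbrella {x} {y} {w} x≤y y≤w (proj₂ (x≈z w) z⌢w))
    ... | inj₂ w≤y = ⌢-sym (proj₁ (umbrella {w} {y} {z} w≤y y≤z (⌢-sym z⌢w)))

  -- Agreement of two umbrella orderings on edges between non-twins.

  Agree : Ordering n → Ordering n → Rel (Fin n) 0ℓ
  Agree σ τ x y = (x <[ σ ] y × x <[ τ ] y) ⊎ (y <[ σ ] x × y <[ τ ] x)

  agree-reversed : ∀ σ τ {x y} → Agree σ τ x y → Agree (reversed σ) (reversed τ) x y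
  agree-reversed σ τ (inj₁ (σ< , τ<)) = inj₂ (reversed-< σ σ< , reversed-< τ τ<)
  agree-reversed σ τ (inj₂ (σ< , τ<)) = inj₁ (reversed-< σ σ< , reversed-< τ τ<)

  agree-reversed⁻ : ∀ σ τ {x y} → Agree (reversed σ) (reversed τ) x y → Agree σ τ x y
  agree-reversed⁻ σ τ (inj₁ (σ< , τ<)) = inj₂ (reversed-<⁻ σ σ< , reversed-<⁻ τ τ<)
  agree-reversed⁻ σ τ (inj₂ (σ< , τ<)) = inj₁ (reversed-<⁻ σ σ< , reversed-<⁻ τ τ<)

  agree⇒< : ∀ σ τ {x y} → Agree σ τ x y → x <[ σ ] y → x <[ τ ] y
  agree⇒< σ τ (inj₁ (_ , x<y)) _   = x<y
  agree⇒< σ τ (inj₂ (y<x , _)) x<y = contradiction x<y (ℕ.<-asym y<x)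

  agree-or-reverse : ∀ σ τ {x y} → x ≢ y → Agree σ τ x y ⊎ Agree σ (reversed τ) x y
  agree-or-reverse σ τ {x} {y} x≢y with order-cmp σ x y | order-cmp τ x y
  ... | inj₂ (inj₁ x≡y) | _ = contradiction x≡y x≢y
  ... | _ | inj₂ (inj₁ x≡y) = contradiction x≡y x≢y
  ... | inj₁ x<y | inj₁ x<′y = inj₁ (inj₁ (x<y , x<′y))
  ... | inj₁ x<y | inj₂ (inj₂ y<′x) = inj₂ (inj₁ (x<y , reversed-< τ y<′x))
  ... | inj₂ (inj₂ y<x) | inj₁ x<′y = inj₂ (inj₂ (y<x , reversed-< τ x<′y))
  ... | inj₂ (inj₂ y<x) | inj₂ (inj₂ y<′x) = inj₁ (inj₂ (y<x , y<′x))

  module _ {σ τ : Ordering n} (σ-umbrella : UmbrellaOrdering σ) (τ-umbrella : UmbrellaOrdering τ) where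

    private
      σ-monotone : InducedPathsMonotone σ
      σ-monotone = umbrella⇒monotone σ σ-umbrella

      τ-monotone : InducedPathsMonotone τ
      τ-monotone = umbrella⇒monotone τ τ-umbrella

    -- A vertex separating a from b completes both ab and ac to induced paths
    -- on three vertices.
    triangle-< : ∀ {a b c} → a <[ σ ] b → b <[ σ ] c → a ⌢ c → ¬ a ≈ b →
                 (a <[ τ ] b → a <[ τ ] c) × (a <[ τ ] c → a <[ τ ] b)
    triangle-< {a} {b} {c} a<b b<c a⌢c a≉b
      with a⌢b , b⌢c ← σ-umbrella {a} {b} {c} (ℕ.<⇒≤ a<b) (ℕ.<⇒≤ b<c) a⌢c
      with separator a≉b
    ... | w , inj₁ (a⌢w , b¬⌢w) = b⇒c , c⇒b
      where
      w<a : w <[ σ ] a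
      w<a with σ-monotone (⌢-sym a⌢w) a⌢b (b¬⌢w ∘ ⌢-sym)
      ... | inj₁ (w<a , _) = w<a
      ... | inj₂ (b<a , _) = contradiction b<a (ℕ.<-asym a<b)

      w¬⌢c : ¬ w ⌢ c
      w¬⌢c w⌢c = b¬⌢w (⌢-sym (proj₁
        (σ-umbrella {w} {b} {c} (ℕ.<⇒≤ (ℕ.<-trans w<a a<b)) (ℕ.<⇒≤ b<c) w⌢c)))

      b⇒c : a <[ τ ] b → a <[ τ ] c
      b⇒c a<′b with τ-monotone (⌢-sym a⌢w) a⌢b (b¬⌢w ∘ ⌢-sym) | τ-monotone (⌢-sym a⌢w) a⌢c w¬⌢c
      ... | _                | inj₁ (_ , a<′c)  = a<′c
      ... | inj₁ (w<′a , _)  | inj₂ (_ , a<′w)  = contradiction a<′w (ℕ.<-asym w<′a)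
      ... | inj₂ (b<′a , _)  | _                = contradiction b<′a (ℕ.<-asym a<′b)

      c⇒b : a <[ τ ] c → a <[ τ ] b
      c⇒b a<′c with τ-monotone (⌢-sym a⌢w) a⌢b (b¬⌢w ∘ ⌢-sym) | τ-monotone (⌢-sym a⌢w) a⌢c w¬⌢c
      ... | inj₁ (_ , a<′b)  | _                = a<′b
      ... | inj₂ (_ , a<′w)  | inj₁ (w<′a , _)  = contradiction a<′w (ℕ.<-asym w<′a)
      ... | _                | inj₂ (c<′a , _)  = contradiction c<′a (ℕ.<-asym a<′c)
    ... | w , inj₂ (b⌢w , a¬⌢w) = b⇒c , c⇒b
      where
      b<w : b <[ σ ] w
      b<w with σ-monotone a⌢b b⌢w a¬⌢w
      ... | inj₁ (_ , b<w) = b<w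
      ... | inj₂ (_ , b<a) = contradiction b<a (ℕ.<-asym a<b)

      c⌢w : c ⌢ w
      c⌢w with order-total σ c w
      ... | inj₁ c≤w = proj₂ (σ-umbrella {b} {c} {w} (ℕ.<⇒≤ b<c) c≤w b⌢w)
      ... | inj₂ w≤c = contradiction
        (proj₁ (σ-umbrella {a} {w} {c} (ℕ.<⇒≤ (ℕ.<-trans a<b b<w)) w≤c a⌢c)) a¬⌢w

      b⇒c : a <[ τ ] b → a <[ τ ] c
      b⇒c a<′b with τ-monotone a⌢b b⌢w a¬⌢w | τ-monotone a⌢c c⌢w a¬⌢w
      ... | _                      | inj₁ (a<′c , _)      = a<′c
      ... | inj₁ (_ , b<′w)        | inj₂ (w<′c , c<′a)   =
        contradiction (ℕ.<-trans w<′c c<′a) (ℕ.<-asym (ℕ.<-trans a<′b b<′w))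
      ... | inj₂ (_ , b<′a)        | _                    = contradiction b<′a (ℕ.<-asym a<′b)

      c⇒b : a <[ τ ] c → a <[ τ ] b
      c⇒b a<′c with τ-monotone a⌢b b⌢w a¬⌢w | τ-monotone a⌢c c⌢w a¬⌢w
      ... | inj₁ (a<′b , _)        | _                    = a<′b
      ... | inj₂ (w<′b , b<′a)     | inj₁ (_ , c<′w)      =
        contradiction (ℕ.<-trans w<′b b<′a) (ℕ.<-asym (ℕ.<-trans a<′c c<′w))
      ... | _                      | inj₂ (_ , c<′a)      = contradiction c<′a (ℕ.<-asym a<′c)

    triangle-first : ∀ {a b c} → a <[ σ ] b → b <[ σ ] c → a ⌢ c → ¬ a ≈ b →
                     (Agree σ τ a b → Agree σ τ a c) × (Agree σ τ a c → Agree σ τ a b)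
    triangle-first {a} {b} {c} a<b b<c a⌢c a≉b
      with b⇒c , c⇒b ← triangle-< {a} {b} {c} a<b b<c a⌢c a≉b
      = (λ ab → inj₁ (a<c , b⇒c (agree⇒< σ τ ab a<b)))
      , (λ ac → inj₁ (a<b , c⇒b (agree⇒< σ τ ac a<c)))
      where a<c = ℕ.<-trans a<b b<c

  module _ (σ τ : Ordering n) (σ-umbrella : UmbrellaOrdering σ) (τ-umbrella : UmbrellaOrdering τ) where

    private
      first = triangle-first {σ} {τ} σ-umbrella τ-umbrella

    -- This is `triangle-first` for the reversed orderings, in which `c` comes first.
    triangle-last : ∀ {a b c} → a <[ σ ] b → b <[ σ ] c → a ⌢ c → ¬ b ≈ c →
                    (Agree σ τ b c → Agree σ τ a c) × (Agree σ τ a c → Agree σ τ b c)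
    triangle-last {a} {b} {c} a<b b<c a⌢c b≉c
      with b⇒a , a⇒b ← triangle-first {reversed σ} {reversed τ}
             (umbrella-reversed σ σ-umbrella) (umbrella-reversed τ τ-umbrella)
             {c} {b} {a} (reversed-< σ b<c) (reversed-< σ a<b) (⌢-sym a⌢c) (b≉c ∘ ≈-sym)
      = onReversed b⇒a , onReversed a⇒b
      where
      onReversed : ∀ {x y} →
        (Agree (reversed σ) (reversed τ) c x → Agree (reversed σ) (reversed τ) c y) →
        Agree σ τ x c → Agree σ τ y c
      onReversed f = Sum.swap ∘ agree-reversed⁻ σ τ ∘ f ∘ agree-reversed σ τ ∘ Sum.swap

    -- If `x` and `z` are not adjacent, the induced path is monotone in both orderings, so the
    -- direction of one edge fixes that of the other. In a triangle the position of `y` in `σ`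
    -- decides: when `y` is first or last, one triangle lemma suffices; when it is in the middle,
    -- agreement passes through the long edge `x z`.
    agree-adjacentEdges : ∀ {x y z} → x ⌢ y → ¬ x ≈ y → y ⌢ z → ¬ y ≈ z →
                          Agree σ τ x y → Agree σ τ y z
    agree-adjacentEdges {x} {y} {z} x⌢y x≉y y⌢z y≉z xy with x ⌢? z
    ... | no x¬⌢z with umbrella⇒monotone σ σ-umbrella x⌢y y⌢z x¬⌢z
                     | umbrella⇒monotone τ τ-umbrella x⌢y y⌢z x¬⌢z
    ...   | inj₁ (_ , y<z)   | inj₁ (_ , y<′z)   = inj₁ (y<z , y<′z)
    ...   | inj₂ (z<y , _)   | inj₂ (z<′y , _)   = inj₂ (z<y , z<′y)
    ...   | inj₁ (x<y , _)   | inj₂ (_ , y<′x)   = contradiction y<′x (ℕ.<-asym (agree⇒< σ τ xy x<y))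
    ...   | inj₂ (_ , y<x)   | inj₁ (x<′y , _)   =
      contradiction x<′y (ℕ.<-asym (agree⇒< σ τ (Sum.swap xy) y<x))
    agree-adjacentEdges {x} {y} {z} x⌢y x≉y y⌢z y≉z xy | yes x⌢z
      with order-cmp σ x y | order-cmp σ y z | order-cmp σ x z
    ... | inj₂ (inj₁ refl) | _ | _ = contradiction ≈-refl x≉y
    ... | _ | inj₂ (inj₁ refl) | _ = contradiction ≈-refl y≉z
    ... | _ | _ | inj₂ (inj₁ refl) = Sum.swap xy
    ... | inj₁ x<y | inj₁ y<z | _ =
      proj₂ (triangle-last x<y y<z x⌢z y≉z) (proj₁ (first x<y y<z x⌢z x≉y) xy)
    ... | inj₂ (inj₂ y<x) | inj₂ (inj₂ z<y) | _ =
      Sum.swap (proj₂ (first z<y y<x (⌢-sym x⌢z) (y≉z ∘ ≈-sym))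
        (proj₁ (triangle-last z<y y<x (⌢-sym x⌢z) (x≉y ∘ ≈-sym)) (Sum.swap xy)))
    ... | inj₂ (inj₂ y<x) | inj₁ y<z | inj₁ x<z =
      proj₁ (first y<x x<z y⌢z (x≉y ∘ ≈-sym)) (Sum.swap xy)
    ... | inj₂ (inj₂ y<x) | inj₁ y<z | inj₂ (inj₂ z<x) =
      proj₂ (first y<z z<x (⌢-sym x⌢y) y≉z) (Sum.swap xy)
    ... | inj₁ x<y | inj₂ (inj₂ z<y) | inj₁ x<z =
      Sum.swap (proj₂ (triangle-last x<z z<y x⌢y (y≉z ∘ ≈-sym)) xy)
    ... | inj₁ x<y | inj₂ (inj₂ z<y) | inj₂ (inj₂ z<x) =
      Sum.swap (proj₁ (triangle-last z<x x<y (⌢-sym y⌢z) x≉y) xy)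

    agree-edges : ∀ {x y v} → x ⌢ y → ¬ x ≈ y → Agree σ τ x y → Star _~_ x v →
                  ∀ {u} → v ⌢ u → ¬ v ≈ u → Agree σ τ v u
    agree-edges x⌢y x≉y xy x⟶v = spread x⟶v λ x⌢u x≉u →
      agree-adjacentEdges (⌢-sym x⌢y) (x≉y ∘ ≈-sym) x⌢u x≉u (Sum.swap xy)
      where
      EdgesAgree : Fin n → Set
      EdgesAgree v = ∀ {u} → v ⌢ u → ¬ v ≈ u → Agree σ τ v u

      step : ∀ {v w} → v ~ w → EdgesAgree v → EdgesAgree w
      step {v} {w} v~w agree {u} w⌢u w≉u with v ≈? w
      ... | no v≉w = agree-adjacentEdges (inj₁ v~w) v≉w w⌢u w≉u (agree (inj₁ v~w) v≉w)
      -- The edge between the twins `v` and `w` carries no orientation, so agreement travels through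
      -- their common neighbour `u`, from `v u` to `u w`.
      ... | yes v≈w = Sum.swap (agree-adjacentEdges v⌢u v≉u (⌢-sym w⌢u) (w≉u ∘ ≈-sym) (agree v⌢u v≉u))
        where
        v⌢u = proj₂ (v≈w u) w⌢u

        v≉u : ¬ v ≈ u
        v≉u v≈u = w≉u (≈-trans (≈-sym v≈w) v≈u)

      spread : ∀ {v w} → Star _~_ v w → EdgesAgree v → EdgesAgree w
      spread Star.ε agree = agree
      spread (v~w ◅ w⟶) agree = spread w⟶ (step v~w agree)

    -- From edges to all pairs of non-twins.

    module _ (connected : Connected G)
             (edgesAgree : ∀ {x y} → x ⌢ y → ¬ x ≈ y → Agree σ τ x y) where

      ≤-preserved : ∀ {x y} → Star (Ascent σ) x y → x ≤[ τ ] y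
      ≤-preserved Star.ε = ℕ.≤-refl
      ≤-preserved ((x⌢q , x≉q , x<q) ◅ q≤y) =
        ℕ.≤-trans (ℕ.<⇒≤ (agree⇒< σ τ (edgesAgree x⌢q x≉q) x<q)) (≤-preserved q≤y)

      -- Non-adjacent vertices are joined by a monotone path, ascending since `x <[ σ ] y`, and each
      -- of its steps is an edge on which the orderings agree.
      <-preserved : ∀ {x y} → ¬ x ≈ y → x <[ σ ] y → x <[ τ ] y
      <-preserved {x} {y} x≉y x<y with monotonePath σ (umbrella⇒monotone σ σ-umbrella) (connected x y)
      ... | inj₁ x⌢y         = agree⇒< σ τ (edgesAgree x⌢y x≉y) x<y
      ... | inj₂ (inj₂ down) =
        contradiction (reversed-≤⁻ σ (ascents⇒≤ (reversed σ) down)) (ℕ.<⇒≱ x<y)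
      ... | inj₂ (inj₁ up) with order-cmp τ x y
      ...   | inj₁ x<′y         = x<′y
      ...   | inj₂ (inj₁ refl)  = contradiction ≈-refl x≉y
      ...   | inj₂ (inj₂ y<′x)  = contradiction (≤-preserved up) (ℕ.<⇒≱ y<′x)

      <-reflected : ∀ {x y} → ¬ x ≈ y → x <[ τ ] y → x <[ σ ] y
      <-reflected {x} {y} x≉y x<′y with order-cmp σ x y
      ... | inj₁ x<y         = x<y
      ... | inj₂ (inj₁ refl) = contradiction ≈-refl x≉y
      ... | inj₂ (inj₂ y<x)  = contradiction (<-preserved (x≉y ∘ ≈-sym) y<x) (ℕ.<-asym x<′y)

  -- Comparing positions by counting.

  -- Pigeonhole: the vertices up to and including `v` are mapped injectively to the positions that
  -- `τ` has before `w`. Counting `v` itself makes the inequality strict.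
  initialSegment-< : ∀ (σ τ : Ordering n) v w →
                     (∀ {u} → u ≤[ σ ] v → u <[ τ ] w) → σ ⟨$⟩ʳ v F.< τ ⟨$⟩ʳ w
  initialSegment-< σ τ v w below = F.injective⇒≤ {f = f} f-injective
    where
    i≤n : suc (toℕ (σ ⟨$⟩ʳ v)) ℕ.≤ n
    i≤n = F.toℕ<n (σ ⟨$⟩ʳ v)

    vertex : Fin (suc (toℕ (σ ⟨$⟩ʳ v))) → Fin n
    vertex p = σ ⟨$⟩ˡ inject≤ p i≤n

    vertex≤v : ∀ p → vertex p ≤[ σ ] v
    vertex≤v p rewrite inverseʳ σ {inject≤ p i≤n} | F.toℕ-inject≤ p i≤n = ℕ.≤-pred (F.toℕ<n p)

    f : Fin (suc (toℕ (σ ⟨$⟩ʳ v))) → Fin (toℕ (τ ⟨$⟩ʳ w))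
    f p = fromℕ< (below (vertex≤v p))

    f-injective : ∀ {p q} → f p ≡ f q → p ≡ q
    f-injective {p} {q} eq = F.inject≤-injective i≤n i≤n p q (begin
      inject≤ p i≤n    ≡⟨ inverseʳ σ ⟨
      σ ⟨$⟩ʳ vertex p  ≡⟨ cong (σ ⟨$⟩ʳ_) (position-injective τ (F.toℕ-injective
                            (F.fromℕ<-injective _ _ (below (vertex≤v p)) (below (vertex≤v q)) eq))) ⟩
      σ ⟨$⟩ʳ vertex q  ≡⟨ inverseʳ σ ⟩
      inject≤ q i≤n    ∎)
      where open ≡-Reasoning

  -- If `v` and `w` were not twins, convexity of the twin class of `w` would keep every vertex up to
  -- `v` out of it. All of these would then precede `w` in `τ`, too many for the position of `w`.
  samePosition⇒≈ : ∀ σ τ → UmbrellaOrdering σ →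
                   (∀ {x y} → ¬ x ≈ y → x <[ σ ] y → x <[ τ ] y) →
                   ∀ {v w} → v <[ σ ] w → σ ⟨$⟩ʳ v ≡ τ ⟨$⟩ʳ w → v ≈ w
  samePosition⇒≈ σ τ σ-umbrella preserved {v} {w} v<w same = decidable-stable (v ≈? w) λ v≉w →
    ℕ.<-irrefl (cong toℕ same) (initialSegment-< σ τ v w λ {u} u≤v →
      preserved (λ u≈w → v≉w (≈-convex σ σ-umbrella u≤v (ℕ.<⇒≤ v<w) u≈w))
                (ℕ.≤-<-trans u≤v v<w))

  equalUpToTwins : ∀ σ τ → (∀ {v w} → σ ⟨$⟩ʳ v ≡ τ ⟨$⟩ʳ w → w ≈ v) → EqualUpToTwins G σ τ
  equalUpToTwins σ τ same⇒≈ =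
    -- The permutation sends `v` to the vertex that `τ` puts at the position of `v` in `σ`.
    σ ∘ₚ flip τ , (λ v → ≈⇒≡⊎twins (same⇒≈ (sym (inverseʳ τ)))) , λ v → sym (inverseʳ τ)

  edgesAgree⇒equal : ∀ σ τ → UmbrellaOrdering σ → UmbrellaOrdering τ → Connected G →
                     (∀ {x y} → x ⌢ y → ¬ x ≈ y → Agree σ τ x y) → EqualUpToTwins G σ τ
  edgesAgree⇒equal σ τ σ-umbrella τ-umbrella connected edgesAgree = equalUpToTwins σ τ same⇒≈
    where
    same⇒≈ : ∀ {v w} → σ ⟨$⟩ʳ v ≡ τ ⟨$⟩ʳ w → w ≈ v
    same⇒≈ {v} {w} same with w ≈? v | order-cmp σ v w
    ... | yes w≈v | _                = w≈v
    ... | no w≉v  | inj₂ (inj₁ refl) = ≈-refl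
    ... | no w≉v  | inj₁ v<w         =
      ≈-sym (samePosition⇒≈ σ τ σ-umbrella
        (<-preserved σ τ σ-umbrella τ-umbrella connected edgesAgree) v<w same)
    -- The two orderings exchange roles, so `w<v` is first carried over to `τ`.
    ... | no w≉v  | inj₂ (inj₂ w<v)  =
      samePosition⇒≈ τ σ τ-umbrella
        (<-reflected σ τ σ-umbrella τ-umbrella connected edgesAgree)
        (<-preserved σ τ σ-umbrella τ-umbrella connected edgesAgree w≉v w<v) (sym same)

  -- If every edge joins twins, connectivity puts all vertices in one twin class and any permutation
  -- will do. Otherwise a single edge between non-twins decides whether `τ` is to be reversed.
  umbrella-unique : ∀ σ τ → UmbrellaOrdering σ → UmbrellaOrdering τ → Connected G →
                    EqualUpToReversalAndTwins G σ τ
  umbrella-unique σ τ σ-umbrella τ-umbrella connected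
    with F.any? (λ x → F.any? λ y → (x ⌢? y) ×-dec ¬? (x ≈? y))
  ... | no allTwins = inj₁ (equalUpToTwins σ τ λ {v} {w} _ → twins (connected w v))
    where
    twins : ∀ {x y} → Star _~_ x y → x ≈ y
    twins Star.ε = ≈-refl
    twins {x} (_◅_ {j = q} x~q q⟶y) = ≈-trans
      (decidable-stable (x ≈? q) λ x≉q → allTwins (x , q , inj₁ x~q , x≉q)) (twins q⟶y)
  ... | yes (x , y , x⌢y , x≉y) =
    Sum.map (equal τ τ-umbrella) (equal (reversed τ) (umbrella-reversed τ τ-umbrella))
      (agree-or-reverse σ τ λ x≡y → x≉y (subst (x ≈_) x≡y ≈-refl))
    where
    equal : ∀ ρ → UmbrellaOrdering ρ → Agree σ ρ x y → EqualUpToTwins G σ ρ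
    equal ρ ρ-umbrella xy = edgesAgree⇒equal σ ρ σ-umbrella ρ-umbrella connected λ {v} →
      agree-edges σ ρ σ-umbrella ρ-umbrella x⌢y x≉y xy (connected x v)

  -- Orderings defined by adjacency.

  leftRight⇒umbrella : ∀ σ → LeftRight G σ → UmbrellaOrdering σ
  leftRight⇒umbrella σ split = umbrella⁺ σ λ a<b b<c a~c →
    let a~b , b~c = split a<b b<c a~c in inj₁ a~b , inj₁ b~c

  consecutive⇒umbrella : ∀ σ → ConsecutiveNeighbourhood G σ → UmbrellaOrdering σ
  consecutive⇒umbrella σ consecutive = umbrella⁺ σ λ {a} {b} {c} a<b b<c a~c →
    consecutive a a<b b<c ⌢-refl (inj₁ a~c) ,
    ⌢-sym (consecutive c a<b b<c (inj₁ (~-sym a~c)) ⌢-refl)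

  indifference⇒monotone : ∀ σ → Indifference G σ → InducedPathsMonotone σ
  indifference⇒monotone σ middle {a} {b} {c} a⌢b b⌢c a¬⌢c =
    middle (λ a≡c → a¬⌢c (inj₂ a≡c))
      (⌢⇒~ a⌢b λ { refl → a¬⌢c b⌢c }) (⌢⇒~ b⌢c λ { refl → a¬⌢c a⌢b }) (a¬⌢c ∘ inj₁)

  -- Two neighbours of `b` on the same side of it belong to a clique, so the non-adjacent `a` and
  -- `c` lie on opposite sides.
  bisimplicial⇒monotone : ∀ σ → BisimplicialElimination G σ → InducedPathsMonotone σ
  bisimplicial⇒monotone σ (simplicial , simplicial-reversed) {a} {b} {c} a⌢b b⌢c a¬⌢c
    with order-cmp σ a b | order-cmp σ b c
  ... | inj₂ (inj₁ refl) | _                = contradiction b⌢c a¬⌢c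
  ... | _                | inj₂ (inj₁ refl) = contradiction a⌢b a¬⌢c
  ... | inj₁ a<b         | inj₁ b<c         = inj₁ (a<b , b<c)
  ... | inj₂ (inj₂ b<a)  | inj₂ (inj₂ c<b)  = inj₂ (c<b , b<a)
  ... | inj₁ a<b         | inj₂ (inj₂ c<b)  = contradiction
    (inj₁ (simplicial b
      (⌢⇒~ (⌢-sym a⌢b) (<⇒≢-order σ a<b ∘ sym) , a<b)
      (⌢⇒~ b⌢c (<⇒≢-order σ c<b ∘ sym) , c<b) (a¬⌢c ∘ inj₂))) a¬⌢c
  ... | inj₂ (inj₂ b<a)  | inj₁ b<c         = contradiction
    (inj₁ (simplicial-reversed b
      (⌢⇒~ (⌢-sym a⌢b) (<⇒≢-order σ b<a) , reversed-< σ b<a)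
      (⌢⇒~ b⌢c (<⇒≢-order σ b<c) , reversed-< σ b<c) (a¬⌢c ∘ inj₂))) a¬⌢c

  -- Left endpoints in a realizer.

  module _ (R : Realizer G) where

    I : Fin n → Interval
    I = interval R

    infix 4 _≼_
    _≼_ : Rel (Fin n) 0ℓ
    x ≼ y = left (I x) ≤ᴿ left (I y)

    -- The left endpoint of `c` is at most the right endpoint of `a`. Hence the left endpoint of `b`
    -- lies in both `I a` and `I b`; by equal widths `I b` ends no earlier than `I a`, so the left
    -- endpoint of `c` lies in both `I b` and `I c`.
    left-umbrella : Umbrella _≼_
    left-umbrella {a} {b} {c} a≼b b≼c a⌢c = a⌢b , b⌢c
      where
      left≤right′ : ∀ {x y} → x ⌢ y → left (I y) ≤ᴿ right (I x)
      left≤right′ (inj₂ refl) = left≤right (I _)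
      left≤right′ {x} {y} (inj₁ x~y)
        with z , (_ , z≤x) , (y≤z , _) ← Equivalence.to (realizes R λ x≡y → ~-irrefl x≡y x~y) x~y
        = ≤ᴿ-trans (left (I y)) z (right (I x)) y≤z z≤x

      c≤a = left≤right′ a⌢c

      a⌢b : a ⌢ b
      a⌢b with a F.≟ b
      ... | yes a≡b = inj₂ a≡b
      ... | no  a≢b = inj₁ (Equivalence.from (realizes R a≢b)
        (left (I b) , (a≼b , ≤ᴿ-trans (left (I b)) (left (I c)) (right (I a)) b≼c c≤a)
                    , (≤ᴿ-refl (left (I b)) , left≤right (I b))))

      b⌢c : b ⌢ c
      b⌢c with b F.≟ c
      ... | yes b≡c = inj₂ b≡c
      ... | no  b≢c = inj₁ (Equivalence.from (realizes R b≢c)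
        (left (I c)
        , (b≼c , ≤ᴿ-trans (left (I c)) (right (I a)) (right (I b)) c≤a
                   (≤ᴿ-width (I a) (I b) (proj₁ (sameWidth R a b)) a≼b))
        , (≤ᴿ-refl (left (I c)) , left≤right (I c))))

    -- Double negation can be moved out of a quantifier over finitely many vertices.
    left-¬¬total : ¬ ¬ (∀ x y → x ≼ y ⊎ y ≼ x)
    left-¬¬total = F.sequence rawApplicative λ x → F.sequence rawApplicative λ y →
      ≤ᴿ-¬¬total (left (I x)) (left (I y))
      where open RawMonad ¬¬-Monad

    intervalOrdering⇒umbrella : ∀ σ → IntervalOrderingOf G R σ → UmbrellaOrdering σ
    intervalOrdering⇒umbrella σ sorted = umbrella⁺ σ λ a<b b<c a~c →
      left-umbrella (sorted a<b) (sorted b<c) (inj₁ a~c)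

  -- Degrees and nested neighbourhoods.

  -- The length is `suc (degree G x)` by computation.
  closedNeighbours : Fin n → List (Fin n)
  closedNeighbours x = x ∷ filter (x ~?_) (allFin n)

  ∈-closedNeighbours⁺ : ∀ {x w} → x ⌢ w → w ∈ˡ closedNeighbours x
  ∈-closedNeighbours⁺ (inj₁ x~w)  = there (∈-filter⁺ (_ ~?_) (∈-allFin _) x~w)
  ∈-closedNeighbours⁺ (inj₂ refl) = here refl

  ∈-closedNeighbours⁻ : ∀ {x w} → w ∈ˡ closedNeighbours x → x ⌢ w
  ∈-closedNeighbours⁻ (here refl) = ⌢-refl
  ∈-closedNeighbours⁻ {x} (there w∈) = inj₁ (proj₂ (∈-filter⁻ (x ~?_) {xs = allFin n} w∈))

  closedNeighbours-unique : ∀ x → Unique (closedNeighbours x)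
  closedNeighbours-unique x =
    All.tabulate (λ { w∈ refl → ~-irrefl refl (proj₂ (∈-filter⁻ (x ~?_) {xs = allFin n} w∈)) }) ∷
    Unique.filter⁺ (x ~?_) (Unique.allFin⁺ n)

  -- A vertex `w` adjacent to `y` but not to `x` could be added to the closed neighbours of `x`,
  -- giving more vertices than `y` has closed neighbours.
  ⊆∧degree≤⇒≈ : ∀ {x y} → (∀ {w} → x ⌢ w → y ⌢ w) → degree G y ℕ.≤ degree G x → x ≈ y
  ⊆∧degree≤⇒≈ {x} {y} x⊆y deg≤ w = x⊆y , λ y⌢w → decidable-stable (x ⌢? w) λ x¬⌢w →
    ℕ.<⇒≱ (unique-⊆⇒length≤
      (All.tabulate (λ { v∈ refl → x¬⌢w (∈-closedNeighbours⁻ v∈) }) ∷ closedNeighbours-unique x)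
      λ { (here refl) → ∈-closedNeighbours⁺ y⌢w
        ; (there v∈)  → ∈-closedNeighbours⁺ (x⊆y (∈-closedNeighbours⁻ v∈)) })
      (s≤s deg≤)

  -- Breadth first search by increasing degree.

  module _ {_≼_ : Rel (Fin n) 0ℓ} (≼-total : Total _≼_) (≼-umbrella : Umbrella _≼_) where

    open DecMembership (F._≟_ {n}) using () renaming (_∈?_ to _∈ˡ?_)

    infix 4 _⊑_
    -- Degrees cannot tell twins apart, so the search recovers `≼` only up to twins.
    _⊑_ : Rel (Fin n) 0ℓ
    x ⊑ y = x ≼ y ⊎ x ≈ y

    ⊑-umbrella : Umbrella _⊑_
    ⊑-umbrella (inj₂ a≈b) _          a⌢c = ≈⇒⌢ a≈b , proj₁ (a≈b _) a⌢c
    ⊑-umbrella (inj₁ _)   (inj₂ b≈c) a⌢c = ⌢-sym (proj₂ (b≈c _) (⌢-sym a⌢c)) , ≈⇒⌢ b≈c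
    ⊑-umbrella (inj₁ a≼b) (inj₁ b≼c) a⌢c = ≼-umbrella a≼b b≼c a⌢c

    -- `before` expresses that the search sweeps from left to right; `closed` excludes processed
    -- vertices from the neighbours of a newly discovered one.
    record Invariant (s : State G) : Set where
      discovered : List (Fin n)
      discovered = proj₁ s ++ proj₂ s
      field
        sorted : AllPairs _⊑_ discovered
        before : ∀ {x z} → x ∈ˡ discovered → z ∉ˡ discovered → x ≼ z
        closed : ∀ {v z} → v ∈ˡ proj₁ s → v ⌢ z → z ∈ˡ discovered

    invariant-step : ∀ {s s′} → (G ⟶ s) s′ → Invariant s → Invariant s′
    invariant-step (process {done} {v} {queue} {new} _ new⇔ degree-sorted) inv = record
      { sorted = subst (AllPairs _⊑_) (sym discovered′≡) (AllPairs.++⁺ sorted new-sorted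
          (All.tabulate λ x∈ → All.tabulate λ y∈new → inj₁ (before x∈ (new-undiscovered y∈new))))
      ; before = λ x∈ z∉ → before′ (split x∈) (z∉ ∘ old) (z∉ ∘ fresh)
      ; closed = closed′
      }
      where
      open Invariant inv

      discovered′≡ : (done ∷ʳ v) ++ queue ++ new ≡ (done ++ v ∷ queue) ++ new
      discovered′≡ = trans (∷ʳ-++ done v (queue ++ new)) (sym (++-assoc done (v ∷ queue) new))

      split : ∀ {x} → x ∈ˡ (done ∷ʳ v) ++ queue ++ new → x ∈ˡ discovered ⊎ x ∈ˡ new
      split x∈ = ∈-++⁻ discovered (subst (_ ∈ˡ_) discovered′≡ x∈)

      old : ∀ {x} → x ∈ˡ discovered → x ∈ˡ (done ∷ʳ v) ++ queue ++ new
      old x∈ = subst (_ ∈ˡ_) (sym discovered′≡) (∈-++⁺ˡ x∈)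

      fresh : ∀ {x} → x ∈ˡ new → x ∈ˡ (done ∷ʳ v) ++ queue ++ new
      fresh x∈ = subst (_ ∈ˡ_) (sym discovered′≡) (∈-++⁺ʳ discovered x∈)

      v∈discovered : v ∈ˡ discovered
      v∈discovered = ∈-++⁺ʳ done (here refl)

      new-undiscovered : ∀ {x} → x ∈ˡ new → x ∉ˡ discovered
      new-undiscovered x∈new = proj₂ (Equivalence.to (new⇔ _) x∈new)

      v⌢new : ∀ {x} → x ∈ˡ new → v ⌢ x
      v⌢new x∈new = inj₁ (proj₁ (Equivalence.to (new⇔ _) x∈new))

      discovered-or-new : ∀ {z} → v ⌢ z → z ∈ˡ discovered ⊎ z ∈ˡ new
      discovered-or-new (inj₂ refl) = inj₁ v∈discovered
      discovered-or-new {z} (inj₁ v~z) with z ∈ˡ? discovered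
      ... | yes z∈ = inj₁ z∈
      ... | no z∉  = inj₂ (Equivalence.from (new⇔ z) (v~z , z∉))

      before′ : ∀ {x z} → x ∈ˡ discovered ⊎ x ∈ˡ new → z ∉ˡ discovered → z ∉ˡ new → x ≼ z
      before′ (inj₁ x∈) z∉ _ = before x∈ z∉
      before′ {x} {z} (inj₂ x∈new) z∉ z∉new with ≼-total x z
      ... | inj₁ x≼z = x≼z
      -- Here `z` would lie under the edge from `v` to `x`, hence be a neighbour of `v` and
      -- discovered by now.
      ... | inj₂ z≼x = contradiction
        (discovered-or-new (proj₁ (≼-umbrella (before v∈discovered z∉) z≼x (v⌢new x∈new))))
        [ z∉ , z∉new ]′

      closed′ : ∀ {u z} → u ∈ˡ done ∷ʳ v → u ⌢ z → z ∈ˡ (done ∷ʳ v) ++ queue ++ new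
      closed′ u∈ u⌢z with ∈-++⁻ done u∈
      ... | inj₁ u∈done      = old (closed u∈done u⌢z)
      ... | inj₂ (here refl) = [ old , fresh ]′ (discovered-or-new u⌢z)

      -- x has no neighbour left of v: such a vertex would be processed
      -- already, and x discovered.  Hence it has no neighbour that the
      -- vertex y to its right lacks, and the degrees decide.
      neighbours-⊆ : ∀ {x y} → x ∈ˡ new → y ∈ˡ new → x ≼ y → ∀ {w} → x ⌢ w → y ⌢ w
      neighbours-⊆ {x} {y} x∈new y∈new x≼y {w} x⌢w =
        [ fromLeft , (λ y≼w → proj₂ (≼-umbrella x≼y y≼w x⌢w)) ]′ (≼-total w y)
        where
        v≼w⇒y⌢w : v ≼ w → w ≼ y → y ⌢ w
        v≼w⇒y⌢w v≼w w≼y = ⌢-sym (proj₂ (≼-umbrella v≼w w≼y (v⌢new y∈new)))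

        fromQueue : w ≼ y → w ∈ˡ v ∷ queue → y ⌢ w
        fromQueue _   (here refl)     = ⌢-sym (v⌢new y∈new)
        fromQueue w≼y (there w∈queue) =
          -- A queued `w` comes after `v`: it lies under the edge from `v` to `y`, or it has the
          -- same closed neighbourhood as `v`, which contains `y`.
          [ (λ v≼w → v≼w⇒y⌢w v≼w w≼y) , (λ v≈w → ⌢-sym (proj₁ (v≈w y) (v⌢new y∈new))) ]′
            (All.lookup (allPairs-++-∷ done sorted) w∈queue)

        fromDone : w ∈ˡ done → y ⌢ w
        fromDone w∈done = contradiction (closed w∈done (⌢-sym x⌢w)) (new-undiscovered x∈new)

        fromLeft : w ≼ y → y ⌢ w
        fromLeft w≼y with w ∈ˡ? discovered
        ... | yes w∈ = [ fromDone , fromQueue w≼y ]′ (∈-++⁻ done w∈)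
        ... | no w∉  = v≼w⇒y⌢w (before v∈discovered w∉) w≼y

      new-sorted : AllPairs _⊑_ new
      new-sorted = allPairs-∈ ⊑-by-degree
        (AllPairs.map⁻ (Sorted⇒AllPairs ℕ.≤-totalOrder degree-sorted))
        where
        ⊑-by-degree : ∀ {x y} → x ∈ˡ new → y ∈ˡ new → degree G x ℕ.≤ degree G y → x ⊑ y
        ⊑-by-degree {x} {y} x∈new y∈new deg≤ with ≼-total x y
        ... | inj₁ x≼y = inj₁ x≼y
        -- The closed neighbourhood of `y` is contained in that of `x`, yet its degree is no
        -- smaller, so the two coincide.
        ... | inj₂ y≼x = inj₂ (≈-sym (⊆∧degree≤⇒≈ (neighbours-⊆ y∈new x∈new y≼x) deg≤))

    invariant-steps : ∀ {s s′} → Star (G ⟶_) s s′ → Invariant s → Invariant s′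
    invariant-steps Star.ε                inv = inv
    invariant-steps (step ◅ steps) inv = invariant-steps steps (invariant-step step inv)

    minBFS-⊑ : ∀ {r} σ → (∀ y → r ≼ y) → MinBFS G r σ → ∀ x y → x <[ σ ] y → x ⊑ y
    minBFS-⊑ {r} σ r-least run x y x<y = subst₂ _⊑_ (inverseˡ σ) (inverseˡ σ)
      (allPairs-tabulate⁻ (subst (AllPairs _⊑_) (++-identityʳ (vertexList σ)) (Invariant.sorted final)) x<y)
      where
      initial : Invariant ([] , [ r ])
      initial = record
        { sorted = [] ∷ []
        -- The search has to start at a leftmost vertex for the sweep to begin.
        ; before = λ { (here refl) _ → r-least _ }
        ; closed = λ ()
        }

      final : Invariant (vertexList σ , [])
      final = invariant-steps run initial

  -- Left endpoints are comparable only up to double negation, which suffices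
  -- because adjacency is decidable.
  minBFS⇒umbrella : ∀ {r} σ → Anchor G r → MinBFS G r σ → UmbrellaOrdering σ
  minBFS⇒umbrella σ (R , r-least) run = umbrella⁺ σ λ {a} {b} {c} a<b b<c a~c →
    decidable-stable ((a ⌢? b) ×-dec (b ⌢? c)) λ ¬umbrella → left-¬¬total R λ total →
      let <⇒⊑ = minBFS-⊑ total (left-umbrella R) σ r-least run
      in ¬umbrella (⊑-umbrella total (left-umbrella R) (<⇒⊑ a b a<b) (<⇒⊑ b c b<c) (inj₁ a~c))

  -- Reduction of all six kinds to umbrella orderings.

  canonical⇒umbrella : ∀ {σ} → Connected G → CanonicalOrdering G σ → UmbrellaOrdering σ
  canonical⇒umbrella {σ} connected = λ where
    (intervalOrdering R p)         → intervalOrdering⇒umbrella R σ p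
    (consecutiveNeighbourhood p)   → consecutive⇒umbrella σ p
    (leftRight p)                  → leftRight⇒umbrella σ p
    (minBFS r anchor run)          → minBFS⇒umbrella σ anchor run
    (indifference p)               → monotone⇒umbrella σ (indifference⇒monotone σ p) connected
    (bisimplicialElimination p)    → monotone⇒umbrella σ (bisimplicial⇒monotone σ p) connected

theorem11 : ∀ {n : ℕ} (G : Graph n) → Connected G → UnitInterval G →
    ∀ (σ τ : Ordering n) →
    CanonicalOrdering G σ → CanonicalOrdering G τ →
    EqualUpToReversalAndTwins G σ τ
theorem11 G connected _ σ τ σ-canonical τ-canonical =
  umbrella-unique G σ τ (canonical⇒umbrella G connected σ-canonical)
    (canonical⇒umbrella G connected τ-canonical) connected
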